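{- Let $G$ be a finite simple connected graph with $\mathrm{fes}(G)=k$. If $k\geq 3$, then $\mathrm{dem}(G)\leq 2k-2$.
   Context: $d_G(x,y)$ denotes the distance between vertices $x,y$ in $G$ (equal to $\infty$ if $x$ and $y$ are in different components), and $G-e$ is the graph obtained from $G$ by deleting the edge $e$. An edge $e$ of $G$ is monitored by a vertex $x$ if there is a vertex $y$ of $G$ with $d_G(x,y)\neq d_{G-e}(x,y)$ (equivalently, $e$ belongs to all shortest paths between $x$ and $y$ in $G$). A set $M\subseteq V(G)$ is distance-edge-monitoring if every edge of $G$ is monitored by some vertex of $M$, and $\mathrm{dem}(G)$ is the smallest size of a distance-edge-monitoring set of $G$. A feedback edge set of $G$ is a set of edges whose removal from $G$ leaves a forest; $\mathrm{fes}(G)$ is the smallest size of a feedback edge set of $G$. -}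

module Defs where

open import Level using (0ℓ)
open import Data.Nat using (ℕ; zero; suc; _+_; _∸_; _≤_; _<_; _≤?_; z≤n; s≤s)
import Data.Nat.Properties as ℕ
open import Data.Nat.Induction using (<-rec)
open import Data.Fin as Fin using (Fin; toℕ)
import Data.Fin.Properties as Fin
open import Data.Fin.Subset using (Subset; ∣_∣; ⊤) renaming (_∈_ to _∈ₛ_)
open import Data.Fin.Subset.Properties using (anySubset?; ∈⊤) renaming (_∈?_ to _∈ₛ?_)
open import Data.List using (List; []; _∷_; _++_; [_]; length; lookup; filter; cartesianProduct; allFin)
open import Data.List.Relation.Unary.All as All using (All)
import Data.List.Relation.Unary.All.Properties as All
open import Data.List.Relation.Unary.Any using (here)
open import Data.List.Relation.Unary.Linked using (Linked; linked?; _∷_)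
open import Data.List.Relation.Unary.Unique.Propositional using (Unique)
open import Data.List.Relation.Unary.AllPairs using (_∷_)
import Data.List.Relation.Unary.Unique.Propositional.Properties as Unique
import Data.List.Relation.Unary.Unique.DecPropositional as DecUnique
open import Data.List.Membership.Propositional using (_∈_; _∉_)
open import Data.List.Membership.Propositional.Properties
  using (∈-filter⁺; ∈-cartesianProduct⁺; ∈-allFin; ∈-lookup)
import Data.List.Membership.DecPropositional as DecMembership
open import Data.Maybe using (Maybe; just; nothing)
import Data.Maybe.Properties as Maybe
open import Data.Product using (∃; ∃-syntax; _×_; _,_; proj₁; proj₂)
import Data.Product.Properties as Product
open import Data.Empty using (⊥-elim)
open import Relation.Binary using (Rel; Decidable; Symmetric; Irreflexive; DecidableEquality; tri<; tri≈; tri>)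
open import Relation.Nullary using (¬_; Dec; yes; no; ¬?; _×-dec_; _→-dec_)
import Relation.Nullary.Decidable as Dec
open import Relation.Binary.PropositionalEquality
  using (_≡_; _≢_; refl; sym; cong; subst)

record Graph (n : ℕ) : Set₁ where
  infix 4 _~_ _~?_
  field
    _~_      : Rel (Fin n) 0ℓ
    _~?_     : Decidable _~_
    ~-sym    : Symmetric _~_
    ~-irrefl : Irreflexive _≡_ _~_

VertexPair : ℕ → Set
VertexPair n = Fin n × Fin n

_≟ᵖ_ : ∀ {n} → DecidableEquality (VertexPair n)
_≟ᵖ_ = Product.≡-dec Fin._≟_ Fin._≟_

-- Each undirected edge is represented once, by its ordered pair of ends u < v.
IsEdge : ∀ {n} → Graph n → VertexPair n → Set
IsEdge G (u , v) = u Fin.< v × u ~ v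
  where open Graph G

-- Duplicate-free, so that the length is the cardinality of the set.
IsEdgeSet : ∀ {n} → Graph n → List (VertexPair n) → Set
IsEdgeSet G F = All (IsEdge G) F × Unique F

infixl 6 _─_

-- The orientation of the pairs in F is ignored.
_─_ : ∀ {n} → Graph n → List (VertexPair n) → Graph n
G ─ F = record
  { _~_      = λ x y → x ~ y × (x , y) ∉ F × (y , x) ∉ F
  ; _~?_     = λ x y → (x ~? y) ×-dec (¬? ((x , y) ∈? F) ×-dec ¬? ((y , x) ∈? F))
  ; ~-sym    = λ (p , q , r) → ~-sym p , r , q
  ; ~-irrefl = λ eq (p , _) → ~-irrefl eq p
  }
  where
  open Graph G
  open DecMembership _≟ᵖ_ using (_∈?_)

infixr 5 _∷_

data Walk {n} (G : Graph n) : Fin n → Fin n → ℕ → Set where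
  []  : ∀ {x} → Walk G x x 0
  _∷_ : ∀ {x y z d} → Graph._~_ G x y → Walk G y z d → Walk G x z (suc d)

Connected : ∀ {n} → Graph n → Set
Connected G = ∀ x y → ∃ (Walk G x y)

-- x ∷ xs lists the vertices of the cycle in cyclic order, starting at x.
IsCycle : ∀ {n} → Graph n → Fin n → List (Fin n) → Set
IsCycle G x xs = 2 ≤ length xs × Unique (x ∷ xs) × Linked _~_ (x ∷ xs ++ [ x ])
  where open Graph G

IsForest : ∀ {n} → Graph n → Set
IsForest G = ¬ (∃[ x ] ∃[ xs ] IsCycle G x xs)

IsLeast : (ℕ → Set) → ℕ → Set
IsLeast P k = P k × (∀ {m} → P m → k ≤ m)

least : {P : ℕ → Set} → (∀ k → Dec (P k)) → ∀ {k} → P k → ∃ (IsLeast P)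
least P? {k} p with P? 0
... | yes p₀ = 0 , p₀ , λ _ → z≤n
least P? {zero}  p | no ¬p₀ = ⊥-elim (¬p₀ p)
least P? {suc k} p | no ¬p₀ = let l , pl , min = least (λ m → P? (suc m)) {k} p in
  suc l , pl , λ { {zero} p₀ → ⊥-elim (¬p₀ p₀) ; {suc m} pm → s≤s (min pm) }

ℕ∞ : Set
ℕ∞ = Maybe ℕ

pattern fin d = just d
pattern ∞     = nothing

IsDist : ∀ {n} → Graph n → Fin n → Fin n → ℕ∞ → Set
IsDist G x y (fin d) = IsLeast (Walk G x y) d
IsDist G x y ∞       = ∀ d → ¬ Walk G x y d

module _ {n} {G : Graph n} where
  open Graph G

  walk? : ∀ x y d → Dec (Walk G x y d)
  walk? x y zero with x Fin.≟ y
  ... | yes refl = yes []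
  ... | no x≢y   = no λ { [] → x≢y refl }
  walk? x y (suc d) with Fin.any? (λ z → (x ~? z) ×-dec walk? z y d)
  ... | yes (z , a , w) = yes (a ∷ w)
  ... | no ¬p           = no λ { (a ∷ w) → ¬p (_ , a , w) }

  infixr 5 _++ʷ_

  _++ʷ_ : ∀ {x y z c d} → Walk G x y c → Walk G y z d → Walk G x z (c + d)
  []      ++ʷ v = v
  (a ∷ w) ++ʷ v = a ∷ (w ++ʷ v)

  vertexAt : ∀ {x y d} → Walk G x y d → Fin (suc d) → Fin n
  vertexAt {x = x} w Fin.zero    = x
  vertexAt (a ∷ w) (Fin.suc i)   = vertexAt w i

  takeʷ : ∀ {x y d} (w : Walk G x y d) i → Walk G x (vertexAt w i) (toℕ i)
  takeʷ w       Fin.zero    = []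
  takeʷ (a ∷ w) (Fin.suc i) = a ∷ takeʷ w i

  dropʷ : ∀ {x y d} (w : Walk G x y d) i → Walk G (vertexAt w i) y (d ∸ toℕ i)
  dropʷ w       Fin.zero    = w
  dropʷ (a ∷ w) (Fin.suc i) = dropʷ w i

  shorten : ∀ {x y d} → n ≤ d → Walk G x y d → ∃[ c ] c < d × Walk G x y c
  shorten {x} {y} {d} n≤d w with Fin.pigeonhole (s≤s n≤d) (vertexAt w)
  ... | i , j , i<j , eq =
    toℕ i + (d ∸ toℕ j)
    , subst (toℕ i + (d ∸ toℕ j) <_) (ℕ.m+[n∸m]≡n (Fin.toℕ≤pred[n] j))
        (ℕ.+-monoˡ-< (d ∸ toℕ j) i<j)
    , takeʷ w i ++ʷ subst (λ v → Walk G v y (d ∸ toℕ j)) (sym eq) (dropʷ w j)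

  shortWalk : ∀ {x y} d → Walk G x y d → ∃[ c ] c < n × Walk G x y c
  shortWalk {x} {y} = <-rec _ λ d rec w → go d rec w (n ≤? d)
    where
    go : ∀ d → (∀ {c} → c < d → Walk G x y c → ∃[ b ] b < n × Walk G x y b) →
         Walk G x y d → Dec (n ≤ d) → ∃[ b ] b < n × Walk G x y b
    go d rec w (no n≰d)  = d , ℕ.≰⇒> n≰d , w
    go d rec w (yes n≤d) with shorten n≤d w
    ... | c , c<d , v = rec c<d v

dist-exists : ∀ {n} (G : Graph n) x y → ∃ (IsDist G x y)
dist-exists {n} G x y with ℕ.anyUpTo? (walk? {G = G} x y) n
... | yes (d , _ , w) = let l , isLeast = least (walk? x y) w in fin l , isLeast
... | no ¬p           = ∞ , λ d w → ¬p (shortWalk d w)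

dist : ∀ {n} → Graph n → Fin n → Fin n → ℕ∞
dist G x y = proj₁ (dist-exists G x y)

dist-isDist : ∀ {n} (G : Graph n) x y → IsDist G x y (dist G x y)
dist-isDist G x y = proj₂ (dist-exists G x y)

Monitors : ∀ {n} → Graph n → Fin n → VertexPair n → Set
Monitors G x e = ∃[ y ] dist G x y ≢ dist (G ─ [ e ]) x y

IsDistanceEdgeMonitoring : ∀ {n} → Graph n → Subset n → Set
IsDistanceEdgeMonitoring G M = ∀ e → IsEdge G e → ∃[ x ] x ∈ₛ M × Monitors G x e

IsFeedbackEdgeSet : ∀ {n} → Graph n → List (VertexPair n) → Set
IsFeedbackEdgeSet G F = IsEdgeSet G F × IsForest (G ─ F)

HasMonitoringSetOfSize : ∀ {n} → Graph n → ℕ → Set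
HasMonitoringSetOfSize G k = ∃[ M ] IsDistanceEdgeMonitoring G M × ∣ M ∣ ≡ k

HasFeedbackEdgeSetOfSize : ∀ {n} → Graph n → ℕ → Set
HasFeedbackEdgeSetOfSize G k = ∃[ F ] IsFeedbackEdgeSet G F × length F ≡ k

anyPair? : ∀ {n} {P : VertexPair n → Set} → (∀ e → Dec (P e)) → Dec (∃ P)
anyPair? P? = Dec.map′ (λ (u , v , p) → (u , v) , p) (λ ((u , v) , p) → u , v , p)
  (Fin.any? λ u → Fin.any? λ v → P? (u , v))

allPair? : ∀ {n} {P : VertexPair n → Set} → (∀ e → Dec (P e)) → Dec (∀ e → P e)
allPair? P? = Dec.map′ (λ f (u , v) → f u v) (λ f u v → f (u , v))
  (Fin.all? λ u → Fin.all? λ v → P? (u , v))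

anyListOfLength? : {A : Set} → (∀ {P : A → Set} → (∀ a → Dec (P a)) → Dec (∃ P)) →
  {P : List A → Set} → (∀ as → Dec (P as)) → ∀ k → Dec (∃[ as ] P as × length as ≡ k)
anyListOfLength? any? P? zero = Dec.map′
  (λ p → [] , p , refl) (λ { ([] , p , _) → p }) (P? [])
anyListOfLength? any? P? (suc k) = Dec.map′
  (λ { (a , as , p , refl) → a ∷ as , p , refl })
  (λ { (a ∷ as , p , refl) → a , as , p , refl })
  (any? λ a → anyListOfLength? any? (λ as → P? (a ∷ as)) k)

lookup-injective : {A : Set} {as : List A} → Unique as →
  ∀ {i j} → lookup as i ≡ lookup as j → i ≡ j
lookup-injective (_  ∷ _) {Fin.zero}  {Fin.zero}  _  = refl
lookup-injective (a∉ ∷ _) {Fin.zero}  {Fin.suc j} eq = ⊥-elim (All.lookup a∉ (∈-lookup j) eq)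
lookup-injective (a∉ ∷ _) {Fin.suc i} {Fin.zero}  eq = ⊥-elim (All.lookup a∉ (∈-lookup i) (sym eq))
lookup-injective (_  ∷ u) {Fin.suc i} {Fin.suc j} eq = cong Fin.suc (lookup-injective u eq)

module _ {n} (G : Graph n) where
  open Graph G

  isEdge? : ∀ e → Dec (IsEdge G e)
  isEdge? (u , v) = (u Fin.<? v) ×-dec (u ~? v)

  isCycle? : ∀ x xs → Dec (IsCycle G x xs)
  isCycle? x xs = (2 ≤? length xs)
    ×-dec (DecUnique.unique? Fin._≟_ (x ∷ xs) ×-dec linked? _~?_ (x ∷ xs ++ [ x ]))

  unique⇒length≤ : ∀ {xs : List (Fin n)} → Unique xs → length xs ≤ n
  unique⇒length≤ u = Fin.injective⇒≤ (lookup-injective u)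

  isForest? : Dec (IsForest G)
  isForest? = ¬? (Dec.map′
    (λ (x , k , _ , xs , c , _) → x , xs , c)
    (λ (x , xs , c) → x , length xs , unique⇒length≤ (proj₁ (proj₂ c)) , xs , c , refl)
    (Fin.any? λ x → ℕ.anyUpTo? (anyListOfLength? Fin.any? (isCycle? x)) n))

  monitors? : ∀ x e → Dec (Monitors G x e)
  monitors? x e = Fin.any? λ y →
    ¬? (Maybe.≡-dec ℕ._≟_ (dist G x y) (dist (G ─ [ e ]) x y))

  isDistanceEdgeMonitoring? : ∀ M → Dec (IsDistanceEdgeMonitoring G M)
  isDistanceEdgeMonitoring? M = allPair? λ e →
    isEdge? e →-dec Fin.any? λ x → (x ∈ₛ? M) ×-dec monitors? x e

  hasMonitoringSetOfSize? : ∀ k → Dec (HasMonitoringSetOfSize G k)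
  hasMonitoringSetOfSize? k = anySubset? λ M →
    isDistanceEdgeMonitoring? M ×-dec (∣ M ∣ ℕ.≟ k)

  endMonitors : ∀ {u v} → u ~ v → Monitors G u (u , v)
  endMonitors {u} {v} u~v = v , go (dist-isDist G u v) (dist-isDist (G ─ [ u , v ]) u v)
    where
    go : ∀ {a b} → IsDist G u v a → IsDist (G ─ [ u , v ]) u v b → a ≢ b
    go {∞}     none      _       refl = none 1 (u~v ∷ [])
    go {fin d} (_ , min) (w , _) refl = absurd (min (u~v ∷ [])) w
      where
      absurd : ∀ {c} → c ≤ 1 → ¬ Walk (G ─ [ u , v ]) u v c
      absurd _        []                   = ~-irrefl refl u~v
      absurd _        ((_ , uv∉ , _) ∷ []) = uv∉ (here refl)
      absurd (s≤s ()) (_ ∷ (_ ∷ _))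

  ⊤-isDistanceEdgeMonitoring : IsDistanceEdgeMonitoring G ⊤
  ⊤-isDistanceEdgeMonitoring (u , v) (_ , u~v) = u , ∈⊤ , endMonitors u~v

  dem-exists : ∃ (IsLeast (HasMonitoringSetOfSize G))
  dem-exists = least hasMonitoringSetOfSize? (⊤ , ⊤-isDistanceEdgeMonitoring , refl)

  dem : ℕ
  dem = proj₁ dem-exists

  dem-isLeast : IsLeast (HasMonitoringSetOfSize G) dem
  dem-isLeast = proj₂ dem-exists

module _ {n} (G : Graph n) where
  open Graph G

  isFeedbackEdgeSet? : ∀ F → Dec (IsFeedbackEdgeSet G F)
  isFeedbackEdgeSet? F =
    (All.all? (isEdge? G) F ×-dec DecUnique.unique? _≟ᵖ_ F) ×-dec isForest? (G ─ F)

  hasFeedbackEdgeSetOfSize? : ∀ k → Dec (HasFeedbackEdgeSetOfSize G k)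
  hasFeedbackEdgeSetOfSize? = anyListOfLength? anyPair? isFeedbackEdgeSet?

  allEdges : List (VertexPair n)
  allEdges = filter (isEdge? G) (cartesianProduct (allFin n) (allFin n))

  ∈-allEdges : ∀ {e} → IsEdge G e → e ∈ allEdges
  ∈-allEdges = ∈-filter⁺ (isEdge? G) (∈-cartesianProduct⁺ (∈-allFin _) (∈-allFin _))

  allEdges-isEdgeSet : IsEdgeSet G allEdges
  allEdges-isEdgeSet = All.all-filter (isEdge? G) (cartesianProduct (allFin n) (allFin n))
    , Unique.filter⁺ (isEdge? G) (Unique.cartesianProduct⁺ (Unique.allFin⁺ n) (Unique.allFin⁺ n))

  edgeless : ∀ {u v} → ¬ Graph._~_ (G ─ allEdges) u v
  edgeless {u} {v} (u~v , uv∉ , vu∉) with Fin.<-cmp u v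
  ... | tri< u<v _ _  = uv∉ (∈-allEdges (u<v , u~v))
  ... | tri≈ _ refl _ = ~-irrefl refl u~v
  ... | tri> _ _ v<u  = vu∉ (∈-allEdges (v<u , ~-sym u~v))

  allEdges-isFeedbackEdgeSet : IsFeedbackEdgeSet G allEdges
  allEdges-isFeedbackEdgeSet = allEdges-isEdgeSet ,
    λ { (_ , []    , () , _)
      ; (_ , _ ∷ _ , _ , _ , x~y ∷ _) → edgeless x~y }

  fes-exists : ∃ (IsLeast (HasFeedbackEdgeSetOfSize G))
  fes-exists = least hasFeedbackEdgeSetOfSize? (allEdges , allEdges-isFeedbackEdgeSet , refl)

  fes : ℕ
  fes = proj₁ fes-exists

  fes-isLeast : IsLeast (HasFeedbackEdgeSetOfSize G) fes
  fes-isLeast = proj₂ fes-exists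

{-# OPTIONS --safe #-}
-- In fact dem G ≤ fes G + 1. Orient every edge away from a root, towards the end
-- farther from it (ties broken by index), and choose for every other vertex one arc
-- entering it; these n - 1 arcs form a tree, and since a forest has at most n - 1
-- edges, at most fes G arcs are left over. Take the root and the heads of the
-- left-over arcs. An edge whose head is not taken is the only arc entering its head,
-- so it ends all shortest paths from the root to that head.
module Submission where

open import Defs
open import Level using (0ℓ)
open import Data.Nat using (ℕ; zero; suc; _+_; _*_; _∸_; _≤_; _<_; z≤n; s≤s)
import Data.Nat.Properties as ℕ
open import Data.Bool using (if_then_else_)
open import Data.Empty using (⊥-elim)
open import Data.Fin as Fin using (Fin)
import Data.Fin.Properties as Fin
open import Data.Fin.Subset
  using (Subset; ∣_∣; _∪_; ⁅_⁆; ⊥; ⊤; inside; outside) renaming (_∈_ to _∈ₛ_)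
open import Data.Fin.Subset.Properties using (x∈⁅x⁆; p⊆p∪q; q⊆p∪q; ∣⁅x⁆∣≡1; ∣⊥∣≡0)
open import Data.Vec using ([]; _∷_)
open import Data.List
  using (List; []; _∷_; _++_; [_]; length; lookup; filter; map; foldr; cartesianProduct; allFin)
import Data.List.Properties as List
open import Data.List.Relation.Unary.All as All using (All; []; _∷_)
import Data.List.Relation.Unary.All.Properties as All
open import Data.List.Relation.Unary.AllPairs using (_∷_; [])
open import Data.List.Relation.Unary.Any as Any using (here; there)
import Data.List.Relation.Unary.Any.Properties as Any
open import Data.List.Relation.Unary.Linked using (Linked; [-]; _∷_)
open import Data.List.Relation.Unary.Unique.Propositional using (Unique)
import Data.List.Relation.Unary.Unique.Propositional.Properties as Unique
open import Data.List.Membership.Propositional using (_∈_; _∉_)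
open import Data.List.Membership.Propositional.Properties
  using (∈-filter⁺; ∈-filter⁻; ∈-cartesianProduct⁺; ∈-allFin; ∈-lookup; ∈-length
        ; ∈-map⁺; ∈-map⁻; ∈-++⁻; ∈-++⁺ˡ; ∈-++⁺ʳ)
import Data.List.Membership.DecPropositional as DecMembership
open import Data.Product using (∃; ∃-syntax; _×_; _,_; proj₁; proj₂)
open import Data.Product.Relation.Binary.Lex.Strict using (×-Lex; ×-decidable; ×-compare; ×-asymmetric)
open import Data.Sum using (_⊎_; inj₁; inj₂)
open import Function using (_∘_)
open import Relation.Binary using (Rel; tri<; tri≈; tri>)
open import Relation.Binary.Construct.Closure.Equivalence as EqClosure using (EqClosure)
open import Relation.Binary.Construct.Closure.ReflexiveTransitive using (Star; ε; _◅_; _◅◅_)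
open import Relation.Binary.Construct.Closure.Symmetric using (SymClosure; fwd; bwd)
open import Relation.Nullary using (¬_; Dec; yes; no; does; ¬?; _×-dec_)
open import Relation.Nullary.Decidable using (dec-true; dec-false)
open import Relation.Binary.PropositionalEquality
  using (_≡_; _≢_; refl; sym; trans; cong; subst; resp₂)

-- Cardinalities of subsets and of duplicate-free lists.

∣p∪q∣≤∣p∣+∣q∣ : ∀ {n} (p q : Subset n) → ∣ p ∪ q ∣ ≤ ∣ p ∣ + ∣ q ∣
∣p∪q∣≤∣p∣+∣q∣ []            []            = z≤n
∣p∪q∣≤∣p∣+∣q∣ (outside ∷ p) (outside ∷ q) = ∣p∪q∣≤∣p∣+∣q∣ p q
∣p∪q∣≤∣p∣+∣q∣ (outside ∷ p) (inside ∷ q)  = subst (suc ∣ p ∪ q ∣ ≤_)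
  (sym (ℕ.+-suc ∣ p ∣ ∣ q ∣)) (s≤s (∣p∪q∣≤∣p∣+∣q∣ p q))
∣p∪q∣≤∣p∣+∣q∣ (inside ∷ p)  (outside ∷ q) = s≤s (∣p∪q∣≤∣p∣+∣q∣ p q)
∣p∪q∣≤∣p∣+∣q∣ (inside ∷ p)  (inside ∷ q)  =
  s≤s (ℕ.≤-trans (∣p∪q∣≤∣p∣+∣q∣ p q) (ℕ.+-monoʳ-≤ ∣ p ∣ (ℕ.n≤1+n ∣ q ∣)))

fromList : ∀ {n} → List (Fin n) → Subset n
fromList = foldr (λ x p → ⁅ x ⁆ ∪ p) ⊥

∈-fromList⁺ : ∀ {n} {x : Fin n} {xs} → x ∈ xs → x ∈ₛ fromList xs
∈-fromList⁺ {x = x} (here refl)            = p⊆p∪q _ (x∈⁅x⁆ x)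
∈-fromList⁺ {xs = y ∷ xs} (there x∈xs) = q⊆p∪q ⁅ y ⁆ _ (∈-fromList⁺ x∈xs)

∣fromList∣≤length : ∀ {n} (xs : List (Fin n)) → ∣ fromList xs ∣ ≤ length xs
∣fromList∣≤length {n} []   = ℕ.≤-reflexive (∣⊥∣≡0 n)
∣fromList∣≤length (x ∷ xs) = ℕ.≤-trans (∣p∪q∣≤∣p∣+∣q∣ ⁅ x ⁆ (fromList xs))
  (ℕ.+-mono-≤ (ℕ.≤-reflexive (∣⁅x⁆∣≡1 x)) (∣fromList∣≤length xs))

-- Sending each index of `xs` to a position of its entry in `ys` is injective.
unique-⊆⇒length≤ : {A : Set} {xs ys : List A} → Unique xs →
  (∀ {x} → x ∈ xs → x ∈ ys) → length xs ≤ length ys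
unique-⊆⇒length≤ {xs = xs} {ys} uniq xs⊆ys = Fin.injective⇒≤ {f = position} λ {i} {j} eq →
  lookup-injective uniq (trans (at i) (trans (cong (lookup ys) eq) (sym (at j))))
  where
  position : Fin (length xs) → Fin (length ys)
  position i = Any.index (xs⊆ys (∈-lookup i))
  at : ∀ i → lookup xs i ≡ lookup ys (position i)
  at i = Any.lookup-index (xs⊆ys (∈-lookup i))

-- Simple paths.

-- The list omits the starting vertex, matching the way `IsCycle` lists the vertices of a cycle.
data Path {A : Set} (R : Rel A 0ℓ) : A → List A → A → Set where
  []  : ∀ {x} → Path R x [] x
  _∷_ : ∀ {x y z xs} → R x y → Path R y xs z → Path R x (y ∷ xs) z

module _ {n} {R : Rel (Fin n) 0ℓ} where
  open DecMembership (Fin._≟_ {n}) using (_∈?_)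

  SimplePath : Fin n → Fin n → Set
  SimplePath x y = ∃[ xs ] Path R x xs y × Unique (x ∷ xs)

  suffix : ∀ {x y z xs} → x ∈ z ∷ xs → Path R z xs y → Unique (z ∷ xs) → SimplePath x y
  suffix (here refl) p       u       = _ , p , u
  suffix (there x∈)  (_ ∷ p) (_ ∷ u) = suffix x∈ p u

  -- Loop erasure: if the new first vertex already lies on the simple path found so far, only the
  -- part from that vertex on is kept.
  simplePath : ∀ {x y} → Star R x y → SimplePath x y
  simplePath ε = [] , [] , [] ∷ []
  simplePath {x} (_◅_ {j = z} a w) with simplePath w
  ... | xs , p , u with x ∈? z ∷ xs
  ...   | yes x∈ = suffix x∈ p u
  ...   | no x∉  = z ∷ xs , a ∷ p , All.¬Any⇒All¬ _ x∉ ∷ u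

path⇒linked : {A : Set} {R S : Rel A 0ℓ} → (∀ {x y} → R x y → S x y) →
  ∀ {x y z xs} → Path R x xs y → S y z → Linked S (x ∷ xs ++ [ z ])
path⇒linked R⇒S []            s = s ∷ [-]
path⇒linked R⇒S (r ∷ [])      s = R⇒S r ∷ s ∷ [-]
path⇒linked R⇒S (r ∷ r₁ ∷ p) s = R⇒S r ∷ path⇒linked R⇒S (r₁ ∷ p) s

-- Counting arcs in a forest.

Arc : ∀ {n} → List (VertexPair n) → Rel (Fin n) 0ℓ
Arc L u v = (u , v) ∈ L

module _ {n} (H : Graph n) (forest : IsForest H) where
  open Graph H

  -- A simple path from `u` to `v` along `L` would close up with the edge `uv` to a cycle. Paths
  -- with fewer than two steps give no cycle; irreflexivity, uniqueness and the absence of the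
  -- reversed arc exclude them.
  forest⇒newArc : ∀ {u v L} → Unique ((u , v) ∷ L) → (v , u) ∉ L →
    All (λ (x , y) → x ~ y) ((u , v) ∷ L) → ¬ EqClosure (Arc L) u v
  forest⇒newArc {u} {v} {L} (uv∉ ∷ _) vu∉ (u~v ∷ L~) conn with simplePath conn
  ... | _ , [] , _              = ~-irrefl refl u~v
  ... | _ , fwd uv∈ ∷ [] , _    = All.All¬⇒¬Any uv∉ uv∈
  ... | _ , bwd vu∈ ∷ [] , _    = vu∉ vu∈
  ... | _ , p@(_ ∷ _ ∷ _) , uniq =
    forest (u , _ , s≤s (s≤s z≤n) , uniq , path⇒linked adjacent p (~-sym u~v))
    where
    adjacent : ∀ {x y} → SymClosure (Arc L) x y → x ~ y
    adjacent (fwd xy∈) = All.lookup L~ xy∈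
    adjacent (bwd yx∈) = ~-sym (All.lookup L~ yx∈)

  -- Every arc merges two components, so one representative becomes redundant.
  forest-representatives : ∀ {L} → Unique L → (∀ {u v} → (u , v) ∈ L → (v , u) ∉ L) →
    All (λ (x , y) → x ~ y) L →
    ∃[ reps ] length reps + length L ≤ n × (∀ x → ∃[ r ] r ∈ reps × EqClosure (Arc L) x r)
  forest-representatives {[]} _ _ _ = allFin n
    , ℕ.≤-reflexive (trans (ℕ.+-identityʳ _) (List.length-tabulate _))
    , λ x → x , ∈-allFin x , ε
  forest-representatives {(u , v) ∷ L} uniq@(_ ∷ uniqL) asym L~@(_ ∷ L~′)
    with forest-representatives uniqL (λ p q → asym (there p) (there q)) L~′
  ... | reps , bound , rep with rep u | rep v
  ...   | a , a∈ , u-a | b , b∈ , v-b =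
    filter ≢b? reps
    , ℕ.≤-trans (subst (_≤ length reps + length L) (sym (ℕ.+-suc _ (length L)))
        (ℕ.+-monoˡ-≤ (length L)
          (List.filter-notAll ≢b? reps (Any.map (λ { refl b≢b → b≢b refl }) b∈))))
        bound
    , rep′
    where
    ≢b? : ∀ r → Dec (r ≢ b)
    ≢b? r = ¬? (r Fin.≟ b)
    weaken : ∀ {x y} → EqClosure (Arc L) x y → EqClosure (Arc ((u , v) ∷ L)) x y
    weaken = EqClosure.map there
    -- With a common representative, `u` and `v` would be connected before the new arc is added.
    a≢b : a ≢ b
    a≢b refl = forest⇒newArc uniq (λ vu∈ → asym (here refl) (there vu∈)) L~
      (u-a ◅◅ EqClosure.symmetric _ v-b)
    b-a : EqClosure (Arc ((u , v) ∷ L)) b a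
    b-a = weaken (EqClosure.symmetric _ v-b) ◅◅ bwd (here refl) ◅ weaken u-a
    rep′ : ∀ x → ∃[ r ] r ∈ filter ≢b? reps × EqClosure (Arc ((u , v) ∷ L)) x r
    rep′ x with rep x
    ... | r , r∈ , x-r with r Fin.≟ b
    ...   | yes refl = a , ∈-filter⁺ ≢b? a∈ a≢b , weaken x-r ◅◅ b-a
    ...   | no r≢b   = r , ∈-filter⁺ ≢b? r∈ r≢b , weaken x-r

  -- The vertex supplied has a representative, so at least one of the `n` places is not taken by an
  -- arc.
  forest-arcs< : ∀ {L} → Fin n → Unique L → (∀ {u v} → (u , v) ∈ L → (v , u) ∉ L) →
    All (λ (x , y) → x ~ y) L → length L < n
  forest-arcs< x uniq asym L~ with forest-representatives uniq asym L~
  ... | reps , bound , rep =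
    ℕ.≤-trans (ℕ.+-monoˡ-≤ _ (∈-length (proj₁ (proj₂ (rep x))))) bound

-- Walks and monitoring.

reverseʷ : ∀ {n} {G : Graph n} {x y d} → Walk G x y d → Walk G y x d
reverseʷ []                          = []
reverseʷ {G = G} (_∷_ {d = d} a w) = subst (Walk G _ _) (ℕ.+-comm d 1)
  (reverseʷ w ++ʷ (Graph.~-sym G a ∷ []))

module _ {n} (G : Graph n) where

  dem≤ : ∀ {M} → IsDistanceEdgeMonitoring G M → dem G ≤ ∣ M ∣
  dem≤ {M} monitoring = proj₂ (dem-isLeast G) {∣ M ∣} (M , monitoring , refl)

  -- If deleting `e` kept the distance from `x` to `y`, a shortest walk in `G ─ [ e ]` would have
  -- length `d`.
  noShortestWalk⇒monitors : ∀ {x y d} e → IsLeast (Walk G x y) d →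
    ¬ Walk (G ─ [ e ]) x y d → Monitors G x e
  noShortestWalk⇒monitors {x} {y} {d} e (w , min) none =
    y , go (dist-isDist G x y) (dist-isDist (G ─ [ e ]) x y)
    where
    go : ∀ {a b} → IsDist G x y a → IsDist (G ─ [ e ]) x y b → a ≢ b
    go {∞}     none′       _        refl = none′ d w
    go {fin c} (w₁ , min₁) (w₂ , _) refl =
      none (subst (Walk (G ─ [ e ]) x y) (ℕ.≤-antisym (min₁ w) (min w₁)) w₂)

-- Tree arcs and extra arcs.

module _ {m} (G : Graph (suc m)) (leastWalk : ∀ v → ∃ (IsLeast (Walk G v Fin.zero))) where
  open Graph G
  open DecMembership (_≟ᵖ_ {suc m}) using (_∈?_)

  root : Fin (suc m)
  root = Fin.zero

  level : Fin (suc m) → ℕ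
  level v = proj₁ (leastWalk v)

  infix 4 _≺_

  _≺_ : Rel (Fin (suc m)) 0ℓ
  u ≺ v = ×-Lex _≡_ _<_ Fin._<_ (level u , u) (level v , v)

  _≺?_ : ∀ u v → Dec (u ≺ v)
  u ≺? v = ×-decidable ℕ._≟_ ℕ._<?_ Fin._<?_ _ _

  ≺-asym : ∀ {u v} → u ≺ v → ¬ v ≺ u
  ≺-asym {u} {v} = ×-asymmetric {_<₁_ = _<_} {_<₂_ = Fin._<_}
    sym (resp₂ _<_) ℕ.<-asym Fin.<-asym {level u , u} {level v , v}

  ≺-total : ∀ {u v} → u ≢ v → u ≺ v ⊎ v ≺ u
  ≺-total u≢v with ×-compare sym ℕ.<-cmp Fin.<-cmp _ _
  ... | tri< u≺v _ _       = inj₁ u≺v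
  ... | tri≈ _ (_ , u≡v) _ = ⊥-elim (u≢v u≡v)
  ... | tri> _ _ v≺u       = inj₂ v≺u

  IsArc : VertexPair (suc m) → Set
  IsArc (u , v) = u ~ v × u ≺ v

  isArc? : ∀ a → Dec (IsArc a)
  isArc? (u , v) = (u ~? v) ×-dec (u ≺? v)

  -- The walk `w` bounds `level p` by `d`, so `p` lies strictly below `v`. Besides choosing parents,
  -- this restricts the first step of a short walk that avoids a given edge.
  firstStep-isArc : ∀ {p v d} → v ~ p → Walk G p root d → d < level v → IsArc (p , v)
  firstStep-isArc {p} v~p w d< =
    ~-sym v~p , inj₁ (ℕ.≤-<-trans (proj₂ (proj₂ (leastWalk p)) w) d<)

  parent-exists : ∀ i → ∃[ p ] IsArc (p , Fin.suc i)
  parent-exists i = parent (proj₁ (proj₂ (leastWalk (Fin.suc i)))) ℕ.≤-refl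
    where
    parent : ∀ {d} → Walk G (Fin.suc i) root d → d ≤ level (Fin.suc i) →
      ∃[ p ] IsArc (p , Fin.suc i)
    parent (v~p ∷ w) d≤ = _ , firstStep-isArc v~p w d≤

  -- The vertices other than `Fin.zero` are the `Fin.suc i`, so indexing by `Fin m` yields exactly
  -- `m` tree arcs, with distinct heads.
  treeArc : Fin m → VertexPair (suc m)
  treeArc i = proj₁ (parent-exists i) , Fin.suc i

  treeArcs : List (VertexPair (suc m))
  treeArcs = map treeArc (allFin m)

  IsExtraArc : VertexPair (suc m) → Set
  IsExtraArc a = IsArc a × a ∉ treeArcs

  isExtraArc? : ∀ a → Dec (IsExtraArc a)
  isExtraArc? a = isArc? a ×-dec ¬? (a ∈? treeArcs)

  allPairs : List (VertexPair (suc m))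
  allPairs = cartesianProduct (allFin (suc m)) (allFin (suc m))

  extraArcs : List (VertexPair (suc m))
  extraArcs = filter isExtraArc? allPairs

  arcs : List (VertexPair (suc m))
  arcs = treeArcs ++ extraArcs

  arcs-isArc : ∀ {a} → a ∈ arcs → IsArc a
  arcs-isArc a∈ with ∈-++⁻ treeArcs a∈
  ... | inj₂ a∈ₑ = proj₁ (proj₂ (∈-filter⁻ isExtraArc? {xs = allPairs} a∈ₑ))
  ... | inj₁ a∈ₜ with ∈-map⁻ treeArc a∈ₜ
  ...   | i , _ , refl = proj₂ (parent-exists i)

  arcs-unique : Unique arcs
  arcs-unique = Unique.++⁺
    (Unique.map⁺ (λ eq → Fin.suc-injective (cong proj₂ eq)) (Unique.allFin⁺ m))
    (Unique.filter⁺ isExtraArc?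
      (Unique.cartesianProduct⁺ (Unique.allFin⁺ (suc m)) (Unique.allFin⁺ (suc m))))
    λ (a∈ₜ , a∈ₑ) → proj₂ (proj₂ (∈-filter⁻ isExtraArc? {xs = allPairs} a∈ₑ)) a∈ₜ

  -- Extra arcs against feedback edges.

  orient : VertexPair (suc m) → VertexPair (suc m)
  orient (u , v) = if does (u ≺? v) then (u , v) else (v , u)

  orient-≺ : ∀ {u v} → u ≺ v → orient (u , v) ≡ (u , v)
  orient-≺ {u} {v} u≺v =
    cong (λ b → if b then (u , v) else (v , u)) (dec-true (u ≺? v) u≺v)

  orient-≻ : ∀ {u v} → v ≺ u → orient (u , v) ≡ (v , u)
  orient-≻ {u} {v} v≺u =
    cong (λ b → if b then (u , v) else (v , u)) (dec-false (u ≺? v) (≺-asym v≺u))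

  -- The arcs outside `map orient F` lie in the forest `G ─ F`, so there are at most `m` of them;
  -- the remaining arcs number at most `length F`. Cancelling the `m` tree arcs leaves the bound.
  extraArcs≤feedback : ∀ F → IsForest (G ─ F) → length extraArcs ≤ length F
  extraArcs≤feedback F forest = ℕ.+-cancelˡ-≤ m _ _ (begin
    m + length extraArcs                ≡⟨ cong (_+ length extraArcs) (sym length-treeArcs) ⟩
    length treeArcs + length extraArcs  ≡⟨ sym (List.length-++ treeArcs) ⟩
    length arcs                         ≤⟨ unique-⊆⇒length≤ arcs-unique split ⟩
    length (rest ++ map orient F)       ≡⟨ List.length-++ rest ⟩
    length rest + length (map orient F) ≡⟨ cong (length rest +_) (List.length-map orient F) ⟩
    length rest + length F              ≤⟨ ℕ.+-monoˡ-≤ (length F) (ℕ.≤-pred rest<) ⟩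
    m + length F                        ∎)
    where
    open ℕ.≤-Reasoning
    length-treeArcs : length treeArcs ≡ m
    length-treeArcs = trans (List.length-map treeArc (allFin m)) (List.length-tabulate _)
    kept? : ∀ a → Dec (a ∉ map orient F)
    kept? a = ¬? (a ∈? map orient F)
    rest : List (VertexPair (suc m))
    rest = filter kept? arcs
    split : ∀ {a} → a ∈ arcs → a ∈ rest ++ map orient F
    split {a} a∈ with a ∈? map orient F
    ... | yes a∈F = ∈-++⁺ʳ rest a∈F
    ... | no a∉F  = ∈-++⁺ˡ (∈-filter⁺ kept? a∈ a∉F)
    arc : ∀ {a} → a ∈ rest → IsArc a
    arc a∈ = arcs-isArc (proj₁ (∈-filter⁻ kept? {xs = arcs} a∈))
    -- If `F` contained the arc in either orientation, `orient` would turn that pair into the arc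
    -- itself.
    survives : ∀ {a} → a ∈ rest → Graph._~_ (G ─ F) (proj₁ a) (proj₂ a)
    survives a∈ = let u~v , u≺v = arc a∈
                      ∉F = proj₂ (∈-filter⁻ kept? {xs = arcs} a∈)
      in u~v
       , (λ ∈F → ∉F (subst (_∈ map orient F) (orient-≺ u≺v) (∈-map⁺ orient ∈F)))
       , (λ ∈F → ∉F (subst (_∈ map orient F) (orient-≻ u≺v) (∈-map⁺ orient ∈F)))
    rest< : length rest < suc m
    rest< = forest-arcs< (G ─ F) forest root (Unique.filter⁺ kept? arcs-unique)
      (λ p q → ≺-asym (proj₂ (arc p)) (proj₂ (arc q))) (All.tabulate survives)

  -- The root and the extra heads monitor every edge.

  -- A stored edge is ordered by index, its arc by `≺`, so the two may disagree.
  Joins : VertexPair (suc m) → Fin (suc m) → Fin (suc m) → Set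
  Joins e u v = e ≡ (u , v) ⊎ e ≡ (v , u)

  deleted : ∀ {e u v} → Joins e u v → ¬ Graph._~_ (G ─ [ e ]) v u
  deleted (inj₁ refl) (_ , _ , uv∉) = uv∉ (here refl)
  deleted (inj₂ refl) (_ , vu∉ , _) = vu∉ (here refl)

  -- The edge itself is the only walk of length `1` from `v` to `u`.
  headMonitors : ∀ {e u v} → Joins e u v → u ~ v → Monitors G v e
  headMonitors {e} {u} {v} joins u~v = noShortestWalk⇒monitors G {d = 1} e
    (~-sym u~v ∷ [] , positive) λ { (v~u ∷ []) → deleted joins v~u }
    where
    positive : ∀ {d} → Walk G v u d → 1 ≤ d
    positive []      = ⊥-elim (~-irrefl refl u~v)
    positive (_ ∷ _) = s≤s z≤n

  -- Read backwards, a shortest walk from the root to `v` first steps from `v` to some `p` with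
  -- `(p , v)` an arc. Then `p` is `u`, and that step is deleted in `G ─ [ e ]`.
  rootMonitors : ∀ {e u v} → Joins e u v → v ≢ root → (∀ {p} → IsArc (p , v) → p ≡ u) →
    Monitors G root e
  rootMonitors {e} {u} {v} joins v≢r onlyArc =
    noShortestWalk⇒monitors G e (reverseʷ w , min ∘ reverseʷ) (avoids ℕ.≤-refl ∘ reverseʷ)
    where
    w : Walk G v root (level v)
    w = proj₁ (proj₂ (leastWalk v))
    min : ∀ {d} → Walk G v root d → level v ≤ d
    min = proj₂ (proj₂ (leastWalk v))
    forget : ∀ {x y d} → Walk (G ─ [ e ]) x y d → Walk G x y d
    forget []           = []
    forget ((a , _) ∷ w) = a ∷ forget w
    avoids : ∀ {d} → d ≤ level v → ¬ Walk (G ─ [ e ]) v root d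
    avoids _  []                        = v≢r refl
    avoids d≤ ((v~p , v~p∈) ∷ w₁) with onlyArc (firstStep-isArc v~p (forget w₁) d≤)
    ... | refl = deleted joins (v~p , v~p∈)

  monitors : List (Fin (suc m))
  monitors = root ∷ map proj₂ extraArcs

  monitored : ∀ {e u v} → Joins e u v → IsArc (u , v) →
    ∃[ x ] x ∈ₛ fromList monitors × Monitors G x e
  monitored {e} {u} {v} joins (u~v , u≺v) with DecMembership._∈?_ Fin._≟_ v monitors
  ... | yes v∈ = v , ∈-fromList⁺ {xs = monitors} v∈ , headMonitors joins u~v
  ... | no v∉  = root , ∈-fromList⁺ {xs = monitors} (here refl) ,
    rootMonitors joins (v∉ ∘ here) λ arc → cong proj₁ (tree-unique (inTree arc) (inTree (u~v , u≺v)))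
    where
    -- An arc into `v` outside the tree would be extra and put `v` among the monitors.
    inTree : ∀ {p} → IsArc (p , v) → (p , v) ∈ treeArcs
    inTree {p} arc with (p , v) ∈? treeArcs
    ... | yes pv∈ = pv∈
    ... | no pv∉  = ⊥-elim (v∉ (there (∈-map⁺ proj₂ (∈-filter⁺ isExtraArc?
      (∈-cartesianProduct⁺ (∈-allFin p) (∈-allFin v)) (arc , pv∉)))))
    tree-unique : ∀ {p q x} → (p , x) ∈ treeArcs → (q , x) ∈ treeArcs → (p , x) ≡ (q , x)
    tree-unique px∈ qx∈ with ∈-map⁻ treeArc px∈ | ∈-map⁻ treeArc qx∈
    ... | i , _ , refl | j , _ , refl = refl

  monitors-isDistanceEdgeMonitoring : IsDistanceEdgeMonitoring G (fromList monitors)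
  monitors-isDistanceEdgeMonitoring (u , v) (u<v , u~v) with ≺-total (Fin.<⇒≢ u<v)
  ... | inj₁ u≺v = monitored (inj₁ refl) (u~v , u≺v)
  ... | inj₂ v≺u = monitored (inj₂ refl) (~-sym u~v , v≺u)

  dem≤1+extraArcs : dem G ≤ suc (length extraArcs)
  dem≤1+extraArcs = begin
    dem G                    ≤⟨ dem≤ G {fromList monitors} monitors-isDistanceEdgeMonitoring ⟩
    ∣ fromList monitors ∣    ≤⟨ ∣fromList∣≤length monitors ⟩
    length monitors          ≡⟨ cong suc (List.length-map proj₂ extraArcs) ⟩
    suc (length extraArcs)   ∎
    where open ℕ.≤-Reasoning

-- The bound in terms of feedback edges.

feedback⇒dem≤ : ∀ {n k} (G : Graph n) → Connected G → HasFeedbackEdgeSetOfSize G k →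
  dem G ≤ suc k
-- Without vertices there is no root, but the full vertex set has size `0`.
feedback⇒dem≤ {zero}  G _ _ = ℕ.≤-trans (dem≤ G (⊤-isDistanceEdgeMonitoring G)) z≤n
feedback⇒dem≤ {suc m} G connected (F , (_ , forest) , refl) =
  ℕ.≤-trans (dem≤1+extraArcs G leastWalk) (s≤s (extraArcs≤feedback G leastWalk F forest))
  where
  leastWalk : ∀ v → ∃ (IsLeast (Walk G v Fin.zero))
  leastWalk v = least (walk? v Fin.zero) (proj₂ (connected v Fin.zero))

1+k≤2k∸2 : ∀ {k} → 3 ≤ k → suc k ≤ 2 * k ∸ 2
-- After the match `k` is the original value minus two, so the claim reads `3 + k ≤ 2 + 2k`, with
-- equality at `k = 1`.
1+k≤2k∸2 {suc (suc k)} (s≤s (s≤s 1≤k)) = begin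
  3 + k                 ≡⟨ ℕ.+-comm 3 k ⟩
  k + 3                 ≤⟨ ℕ.+-monoʳ-≤ k (s≤s (s≤s 1≤k)) ⟩
  k + (2 + k)           ≡⟨ cong (λ l → k + (2 + l)) (sym (ℕ.+-identityʳ k)) ⟩
  2 * (2 + k) ∸ 2       ∎
  where open ℕ.≤-Reasoning

theorem17 : ∀ {n : ℕ} (G : Graph n) (k : ℕ) → Connected G → fes G ≡ k → 3 ≤ k →
    dem G ≤ 2 * k ∸ 2
theorem17 G _ connected refl 3≤k = ℕ.≤-trans (feedback⇒dem≤ G connected (proj₁ (fes-isLeast G))) (1+k≤2k∸2 3≤k)
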